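{- There are infinitely many rational Diophantine sextuples which contain one regular Diophantine quintuple and two regular Diophantine quadruples.
   Context: A rational Diophantine $m$-tuple is a set $\{a_1,\ldots,a_m\}$ of $m$ distinct nonzero rational numbers such that $a_ia_j+1$ is the square of a rational number for all $1\le i<j\le m$. A rational Diophantine quadruple $\{a,b,c,d\}$ is called regular if $(a+b-c-d)^2=4(ab+1)(cd+1)$. A rational Diophantine quintuple $\{a,b,c,d,e\}$ is called regular if $(abcde+2abc+a+b+c-d-e)^2=4(ab+1)(ac+1)(bc+1)(de+1)$. "Contains" means the quadruple or quintuple is a subset of the sextuple. -}

module Defs where

open import Data.Nat using (ℕ)
open import Data.Fin using (Fin; zero; suc)
open import Data.Rational using (ℚ; _+_; _*_; _-_; 0ℚ; 1ℚ)
open import Data.Product using (Σ; ∃; _×_; _,_)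
open import Relation.Binary.PropositionalEquality using (_≡_; _≢_)
open import Relation.Nullary using (¬_)
open import Function.Definitions using (Injective)

IsRatSquare : ℚ → Set
IsRatSquare x = ∃ λ r → x ≡ r * r

IsRatDiophantine : (m : ℕ) → (Fin m → ℚ) → Set
IsRatDiophantine m x =
  Injective _≡_ _≡_ x ×
  (∀ i → x i ≢ 0ℚ) ×
  (∀ i j → i ≢ j → IsRatSquare (x i * x j + 1ℚ))

2ℚ 4ℚ : ℚ
2ℚ = 1ℚ + 1ℚ
4ℚ = 2ℚ + 2ℚ

RegularQuadEq : ℚ → ℚ → ℚ → ℚ → Set
RegularQuadEq a b c d =
  (a + b - c - d) * (a + b - c - d) ≡ 4ℚ * (a * b + 1ℚ) * (c * d + 1ℚ)

RegularQuintEq : ℚ → ℚ → ℚ → ℚ → ℚ → Set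
RegularQuintEq a b c d e =
  let s = a * b * c * d * e + 2ℚ * a * b * c + a + b + c - d - e in
  s * s ≡ 4ℚ * (a * b + 1ℚ) * (a * c + 1ℚ) * (b * c + 1ℚ) * (d * e + 1ℚ)

-- the 4-element subset of the sextuple x given by the injective map h
-- (an enumeration of the subset) is regular for this labelling
RegularQuadIn : (Fin 6 → ℚ) → (Fin 4 → Fin 6) → Set
RegularQuadIn x h =
  Injective _≡_ _≡_ h ×
  RegularQuadEq (x (h zero)) (x (h (suc zero))) (x (h (suc (suc zero))))
                (x (h (suc (suc (suc zero)))))

RegularQuintIn : (Fin 6 → ℚ) → (Fin 5 → Fin 6) → Set
RegularQuintIn x g =
  Injective _≡_ _≡_ g ×
  RegularQuintEq (x (g zero)) (x (g (suc zero))) (x (g (suc (suc zero))))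
                 (x (g (suc (suc (suc zero))))) (x (g (suc (suc (suc (suc zero))))))

ImageSub : {A : Set} {m n : ℕ} → (Fin m → A) → (Fin n → A) → Set
ImageSub {m = m} {n} f g = ∀ (i : Fin m) → ∃ λ (j : Fin n) → f i ≡ g j

SameSet : {A : Set} {m n : ℕ} → (Fin m → A) → (Fin n → A) → Set
SameSet f g = ImageSub f g × ImageSub g f

GoodSextuple : (Fin 6 → ℚ) → Set
GoodSextuple x =
  IsRatDiophantine 6 x ×
  (∃ λ (g : Fin 5 → Fin 6) → RegularQuintIn x g) ×
  (∃ λ (h₁ : Fin 4 → Fin 6) → ∃ λ (h₂ : Fin 4 → Fin 6) →
     RegularQuadIn x h₁ × RegularQuadIn x h₂ × ¬ SameSet h₁ h₂)

{-# OPTIONS --safe #-}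
module Submission where

-- Let {a,f,b,b′}, {a,f,d,d′} and {a,b,b′,d,d′} be regular, and put af+1 = r², bb′+1 = S², dd′+1 = T²,
-- m = (1+r)/a, n = (1-r)/a.  Then b, b′ = ((p ± q)² - (m+n)²) / 2(m+n) with p² = m² + 2Sm + 1 and
-- q² = n² - 2Sn + 1, similarly for d, d′ with T, and the quintuple is regular as soon as ST = S - T.
-- So m and -n are abscissae of points on the elliptic curve p² = m² + 2Sm + 1, P² = m² + 2Tm + 1,
-- and the only pair condition left is that bd+1 be a square.  For S = -(h²+1) the curve has the point M
-- with m = (1-h²) / 2(h²+h+1); taking for -n the abscissa of the residual intersection with the
-- osculating plane at M makes bd+1 a square too, which gives a sextuple of rational functions of h.
-- For h ≥ 31 its members satisfy b′ > b > a > f > d > d′ > 0 and d′ decreases with h.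

open import Defs
open import Algebra.Bundles using (CommutativeRing)
open import Data.Bool using (Bool; true; false; _∧_; T)
import Data.Bool.Properties as Bool
open import Data.Fin as Fin using (Fin; zero; suc; fromℕ)
open import Data.Fin.Patterns
import Data.Fin.Properties as Fin
open import Data.List using (List; []; _∷_; map; reverse)
open import Data.Nat as ℕ using (ℕ; zero; suc; z≤n; s≤s; _≡ᵇ_; _≤ᵇ_; _<ᵇ_)
import Data.Nat.Properties as ℕ
open import Data.Product using (∃; _×_; _,_)
open import Data.Rational
  using (ℚ; _+_; _*_; _-_; 0ℚ; 1ℚ; _≤_; _<_; 1/_; Positive; NonZero; positive; nonNegative)
open import Data.Rational.Properties
open import Algebra.Properties.Semiring.Mult (CommutativeRing.semiring +-*-commutativeRing)
  using (×-homo-+; ×1-homo-*) renaming (_×_ to _·_)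
open import Data.Rational.Solver using (module +-*-Solver)
open import Data.Sum using (inj₁; inj₂)
open import Data.Unit using (tt)
open import Data.Vec using (Vec; []; _∷_; lookup)
open import Data.Vec.Relation.Unary.All using ([]; _∷_)
open import Data.Vec.Relation.Unary.All.Properties using (lookup⁺)
open import Data.Vec.Relation.Unary.AllPairs using (AllPairs; []; _∷_)
open import Function using (Equivalence)
open import Function.Definitions using (Injective)
open import Relation.Binary.Definitions using (Tri; tri<; tri≈; tri>)
open import Relation.Binary.PropositionalEquality
  using (_≡_; _≢_; refl; sym; trans; cong; cong₂; subst; subst₂; module ≡-Reasoning)
open import Relation.Nullary using (¬_; contradiction; True; toWitness; _→-dec_)
open +-*-Solver using (solve; _:=_; _:+_; _:*_; _:-_)

-- Natural numbers inside the rationals.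

-- Unfolding ι at the large literals below would be a unary computation.
abstract

  ι : ℕ → ℚ
  ι n = n · 1ℚ

  ι-0 : ι 0 ≡ 0ℚ
  ι-0 = refl

  ι-1 : ι 1 ≡ 1ℚ
  ι-1 = refl

  ι-2 : ι 2 ≡ 2ℚ
  ι-2 = refl

  ι-+ : ∀ m n → ι (m ℕ.+ n) ≡ ι m + ι n
  ι-+ = ×-homo-+ 1ℚ

  ι-* : ∀ m n → ι (m ℕ.* n) ≡ ι m * ι n
  ι-* = ×1-homo-*

  0≤ι : ∀ n → 0ℚ ≤ ι n
  0≤ι zero    = ≤-refl
  0≤ι (suc n) = +-mono-≤ (<⇒≤ (positive⁻¹ 1ℚ)) (0≤ι n)

  ι-mono-≤ : ∀ {m n} → m ℕ.≤ n → ι m ≤ ι n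
  ι-mono-≤ {n = n} z≤n = 0≤ι n
  ι-mono-≤ (s≤s m≤n)   = +-monoʳ-≤ 1ℚ (ι-mono-≤ m≤n)

  ι-mono-< : ∀ {m n} → m ℕ.< n → ι m < ι n
  ι-mono-< {n = suc n} (s≤s z≤n) = +-mono-<-≤ (positive⁻¹ 1ℚ) (0≤ι n)
  ι-mono-< (s≤s m<n@(s≤s _))     = +-monoʳ-< 1ℚ (ι-mono-< m<n)

-- Polynomials with natural coefficients, constant term first.

evalᶜ : List ℕ → ℚ → ℚ
evalᶜ []      x = 0ℚ
evalᶜ (c ∷ p) x = ι c + x * evalᶜ p x

infixl 6 _+ᶜ_
infixl 7 _*ᶜ_

_+ᶜ_ : List ℕ → List ℕ → List ℕ
[]      +ᶜ q       = q
(a ∷ p) +ᶜ []      = a ∷ p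
(a ∷ p) +ᶜ (b ∷ q) = a ℕ.+ b ∷ p +ᶜ q

_*ᶜ_ : List ℕ → List ℕ → List ℕ
[]      *ᶜ q = []
(a ∷ p) *ᶜ q = map (a ℕ.*_) q +ᶜ (0 ∷ p *ᶜ q)

evalᶜ-+ : ∀ p q x → evalᶜ (p +ᶜ q) x ≡ evalᶜ p x + evalᶜ q x
evalᶜ-+ []      q       x = sym (+-identityˡ _)
evalᶜ-+ (a ∷ p) []      x = sym (+-identityʳ _)
evalᶜ-+ (a ∷ p) (b ∷ q) x
  rewrite ι-+ a b | evalᶜ-+ p q x =
  solve 5 (λ a b x p q → a :+ b :+ x :* (p :+ q) := (a :+ x :* p) :+ (b :+ x :* q)) refl
    (ι a) (ι b) x (evalᶜ p x) (evalᶜ q x)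

evalᶜ-scale : ∀ a q x → evalᶜ (map (a ℕ.*_) q) x ≡ ι a * evalᶜ q x
evalᶜ-scale a []      x = sym (*-zeroʳ (ι a))
evalᶜ-scale a (b ∷ q) x
  rewrite ι-* a b | evalᶜ-scale a q x =
  solve 4 (λ a b x q → a :* b :+ x :* (a :* q) := a :* (b :+ x :* q)) refl
    (ι a) (ι b) x (evalᶜ q x)

evalᶜ-* : ∀ p q x → evalᶜ (p *ᶜ q) x ≡ evalᶜ p x * evalᶜ q x
evalᶜ-* []      q x = sym (*-zeroˡ (evalᶜ q x))
evalᶜ-* (a ∷ p) q x
  rewrite evalᶜ-+ (map (a ℕ.*_) q) (0 ∷ p *ᶜ q) x | evalᶜ-scale a q x | evalᶜ-* p q x
        | ι-0 | +-identityˡ (x * (evalᶜ p x * evalᶜ q x)) =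
  solve 4 (λ a x p q → a :* q :+ x :* (p :* q) := (a :+ x :* p) :* q) refl
    (ι a) x (evalᶜ p x) (evalᶜ q x)

_≡ᶜ_ : List ℕ → List ℕ → Bool
[]      ≡ᶜ []      = true
(a ∷ p) ≡ᶜ (b ∷ q) = (a ≡ᵇ b) ∧ (p ≡ᶜ q)
_       ≡ᶜ _       = false

≡ᶜ⇒≡ : ∀ p q → T (p ≡ᶜ q) → p ≡ q
≡ᶜ⇒≡ []      []      _ = refl
≡ᶜ⇒≡ (a ∷ p) (b ∷ q) t with Equivalence.to Bool.T-∧ t
... | a≡b , p≡q = cong₂ _∷_ (ℕ.≡ᵇ⇒≡ a b a≡b) (≡ᶜ⇒≡ p q p≡q)

_≼_ : List ℕ → List ℕ → Bool
[]      ≼ q       = true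
(a ∷ p) ≼ []      = false
(a ∷ p) ≼ (b ∷ q) = (a ≤ᵇ b) ∧ (p ≼ q)

-- Strictness is asked of the constant terms alone: the inequality is wanted at 0 too, where only
-- they survive, and at positive points the weak comparison of the other coefficients preserves it.
_≺_ : List ℕ → List ℕ → Bool
(a ∷ p) ≺ (b ∷ q) = (a <ᵇ b) ∧ (p ≼ q)
_       ≺ _       = false

module _ {x : ℚ} (0≤x : 0ℚ ≤ x) where

  private instance
    _ = nonNegative 0≤x

  evalᶜ-≼ : ∀ p q → T (p ≼ q) → evalᶜ p x ≤ evalᶜ q x
  evalᶜ-≼ []      []      _ = ≤-refl
  evalᶜ-≼ []      (b ∷ q) _ = subst (_≤ ι b + x * evalᶜ q x) (trans (+-identityˡ _) (*-zeroʳ x))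
    (+-mono-≤ (0≤ι b) (*-monoˡ-≤-nonNeg x (evalᶜ-≼ [] q _)))
  evalᶜ-≼ (a ∷ p) (b ∷ q) t with Equivalence.to Bool.T-∧ t
  ... | a≤b , p≼q =
    +-mono-≤ (ι-mono-≤ (ℕ.≤ᵇ⇒≤ a b a≤b)) (*-monoˡ-≤-nonNeg x (evalᶜ-≼ p q p≼q))

  evalᶜ-≺ : ∀ p q → T (p ≺ q) → evalᶜ p x < evalᶜ q x
  evalᶜ-≺ (a ∷ p) (b ∷ q) t with Equivalence.to Bool.T-∧ t
  ... | a<b , p≼q =
    +-mono-<-≤ (ι-mono-< (ℕ.<ᵇ⇒< a b a<b)) (*-monoˡ-≤-nonNeg x (evalᶜ-≼ p q p≼q))

infixl 6 _⊕_
infixl 7 _⊗_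

-- Without subtraction all coefficients stay natural, so identities and inequalities become
-- computations in `ℕ`. The price is that every identity must be arranged with plus signs only.
data Poly : Set where
  con     : ℕ → Poly
  X       : Poly
  _⊕_ _⊗_ : Poly → Poly → Poly

coeffs : Poly → List ℕ
coeffs (con c) = c ∷ []
coeffs X       = 0 ∷ 1 ∷ []
coeffs (p ⊕ q) = coeffs p +ᶜ coeffs q
coeffs (p ⊗ q) = coeffs p *ᶜ coeffs q

⟦_⟧ : Poly → ℚ → ℚ
⟦ con c ⟧ x = ι c
⟦ X ⟧     x = x
⟦ p ⊕ q ⟧ x = ⟦ p ⟧ x + ⟦ q ⟧ x
⟦ p ⊗ q ⟧ x = ⟦ p ⟧ x * ⟦ q ⟧ x

infix 9 _[_]

_[_] : Poly → Poly → Poly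
con c   [ r ] = con c
X       [ r ] = r
(p ⊕ q) [ r ] = p [ r ] ⊕ q [ r ]
(p ⊗ q) [ r ] = p [ r ] ⊗ q [ r ]

evalᶜ-coeffs : ∀ p x → evalᶜ (coeffs p) x ≡ ⟦ p ⟧ x
evalᶜ-coeffs (con c) x = trans (cong (ι c +_) (*-zeroʳ x)) (+-identityʳ (ι c))
evalᶜ-coeffs X x = begin
  ι 0 + x * (ι 1 + x * 0ℚ)  ≡⟨ cong₂ (λ y z → y + x * (z + x * 0ℚ)) ι-0 ι-1 ⟩
  0ℚ + x * (1ℚ + x * 0ℚ)    ≡⟨ +-identityˡ _ ⟩
  x * (1ℚ + x * 0ℚ)         ≡⟨ cong (λ y → x * (1ℚ + y)) (*-zeroʳ x) ⟩
  x * 1ℚ                    ≡⟨ *-identityʳ x ⟩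
  x                         ∎
  where open ≡-Reasoning
evalᶜ-coeffs (p ⊕ q) x =
  trans (evalᶜ-+ (coeffs p) (coeffs q) x) (cong₂ _+_ (evalᶜ-coeffs p x) (evalᶜ-coeffs q x))
evalᶜ-coeffs (p ⊗ q) x =
  trans (evalᶜ-* (coeffs p) (coeffs q) x) (cong₂ _*_ (evalᶜ-coeffs p x) (evalᶜ-coeffs q x))

⟦⟧-[] : ∀ p r x → ⟦ p [ r ] ⟧ x ≡ ⟦ p ⟧ (⟦ r ⟧ x)
⟦⟧-[] (con c) r x = refl
⟦⟧-[] X       r x = refl
⟦⟧-[] (p ⊕ q) r x = cong₂ _+_ (⟦⟧-[] p r x) (⟦⟧-[] q r x)
⟦⟧-[] (p ⊗ q) r x = cong₂ _*_ (⟦⟧-[] p r x) (⟦⟧-[] q r x)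

-- Comparing inside one Boolean computation; a refl between coefficient lists is much slower to check.
infix 4 _≈_ _≪_

data _≈_ (p q : Poly) : Set where
  by-coeffs : T (coeffs p ≡ᶜ coeffs q) → p ≈ q

data _≪_ (p q : Poly) : Set where
  by-coeffs : T (coeffs p ≺ coeffs q) → p ≪ q

⟦⟧-≈ : ∀ {p q} → p ≈ q → ∀ x → ⟦ p ⟧ x ≡ ⟦ q ⟧ x
⟦⟧-≈ {p} {q} (by-coeffs eq) x =
  trans (sym (evalᶜ-coeffs p x))
    (trans (cong (λ c → evalᶜ c x) (≡ᶜ⇒≡ (coeffs p) (coeffs q) eq)) (evalᶜ-coeffs q x))

⟦⟧-≪ : ∀ {p q} → p ≪ q → ∀ {x} → 0ℚ ≤ x → ⟦ p ⟧ x < ⟦ q ⟧ x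
⟦⟧-≪ {p} {q} (by-coeffs lt) {x} 0≤x =
  subst₂ _<_ (evalᶜ-coeffs p x) (evalᶜ-coeffs q x) (evalᶜ-≺ 0≤x (coeffs p) (coeffs q) lt)

-- Clearing a common denominator `w` with inverse `v`.

module _ {w v : ℚ} (wv≡1 : w * v ≡ 1ℚ) where

  open ≡-Reasoning

  scaled-square : ∀ p q r → p * q + w * w ≡ r * r → p * v * (q * v) + 1ℚ ≡ r * v * (r * v)
  scaled-square p q r eq = begin
    p * v * (q * v) + 1ℚ               ≡⟨ cong₂ (λ x y → p * v * (q * v) + x * y) wv≡1 wv≡1 ⟨
    p * v * (q * v) + w * v * (w * v)  ≡⟨ solve 4 (λ p q w v →
                                            p :* v :* (q :* v) :+ w :* v :* (w :* v) :=
                                            (p :* q :+ w :* w) :* (v :* v)) refl p q w v ⟩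
    (p * q + w * w) * (v * v)          ≡⟨ cong (_* (v * v)) eq ⟩
    r * r * (v * v)                    ≡⟨ solve 2 (λ r v →
                                            r :* r :* (v :* v) := r :* v :* (r :* v)) refl r v ⟩
    r * v * (r * v)                    ∎

  scaled-sum : ∀ a b c d r s → (a + b) * w + 2ℚ * (r * s) ≡ (c + d) * w →
               a * v + b * v + 2ℚ * (r * v * (s * v)) ≡ c * v + d * v
  scaled-sum a b c d r s eq = begin
    a * v + b * v + 2ℚ * (r * v * (s * v))
      ≡⟨ cong (_+ 2ℚ * (r * v * (s * v))) (unscale a b) ⟩
    (a + b) * w * (v * v) + 2ℚ * (r * v * (s * v))
      ≡⟨ solve 6 (λ a+b w r s v two →
           a+b :* w :* (v :* v) :+ two :* (r :* v :* (s :* v)) :=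
           (a+b :* w :+ two :* (r :* s)) :* (v :* v)) refl (a + b) w r s v 2ℚ ⟩
    ((a + b) * w + 2ℚ * (r * s)) * (v * v)
      ≡⟨ cong (_* (v * v)) eq ⟩
    (c + d) * w * (v * v)
      ≡⟨ unscale c d ⟨
    c * v + d * v
      ∎
    where
    unscale : ∀ x y → x * v + y * v ≡ (x + y) * w * (v * v)
    unscale x y = begin
      x * v + y * v                ≡⟨ *-identityʳ _ ⟨
      (x * v + y * v) * 1ℚ         ≡⟨ cong ((x * v + y * v) *_) wv≡1 ⟨
      (x * v + y * v) * (w * v)    ≡⟨ solve 4 (λ x y w v →
                                        (x :* v :+ y :* v) :* (w :* v) :=
                                        (x :+ y) :* w :* (v :* v)) refl x y w v ⟩
      (x + y) * w * (v * v)        ∎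

  -- In `v` the terms have degrees 5, 3, 1 on the left and 4, 1 on the right. Factors `w * v`, equal
  -- to 1, raise all of them to degree 5, and what remains is the hypothesis times the fifth power
  -- of `v`.
  scaled-quint : ∀ a b c d e r₁ r₂ r₃ r₄ →
    a * b * c * d * e + 2ℚ * a * b * c * (w * w) + (a + b + c) * (w * w * w * w) ≡
    2ℚ * (r₁ * r₂ * r₃ * r₄) * w + (d + e) * (w * w * w * w) →
    a * v * (b * v) * (c * v) * (d * v) * (e * v) + 2ℚ * (a * v) * (b * v) * (c * v) +
      (a * v + b * v + c * v) ≡
    2ℚ * (r₁ * v * (r₂ * v) * (r₃ * v) * (r₄ * v)) + (d * v + e * v)
  scaled-quint a b c d e r₁ r₂ r₃ r₄ eq = begin
    abcde + 2abc + a+b+c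
      ≡⟨ cong₂ (λ x y → abcde + x + y) (insert² 2abc) (insert⁴ a+b+c) ⟩
    abcde + 2abc * (w * v * (w * v)) + a+b+c * (w * v * (w * v) * (w * v) * (w * v))
      ≡⟨ solve 8 (λ a b c d e w v two →
           a :* v :* (b :* v) :* (c :* v) :* (d :* v) :* (e :* v) :+
           two :* (a :* v) :* (b :* v) :* (c :* v) :* (w :* v :* (w :* v)) :+
           (a :* v :+ b :* v :+ c :* v) :* (w :* v :* (w :* v) :* (w :* v) :* (w :* v)) :=
           (a :* b :* c :* d :* e :+ two :* a :* b :* c :* (w :* w) :+
            (a :+ b :+ c) :* (w :* w :* w :* w)) :* (v :* v :* v :* v :* v))
           refl a b c d e w v 2ℚ ⟩
    (a * b * c * d * e + 2ℚ * a * b * c * (w * w) + (a + b + c) * (w * w * w * w)) *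
      (v * v * v * v * v)
      ≡⟨ cong (_* (v * v * v * v * v)) eq ⟩
    (2ℚ * (r₁ * r₂ * r₃ * r₄) * w + (d + e) * (w * w * w * w)) * (v * v * v * v * v)
      ≡⟨ solve 9 (λ d e r₁ r₂ r₃ r₄ w v two →
           (two :* (r₁ :* r₂ :* r₃ :* r₄) :* w :+ (d :+ e) :* (w :* w :* w :* w)) :*
           (v :* v :* v :* v :* v) :=
           two :* (r₁ :* v :* (r₂ :* v) :* (r₃ :* v) :* (r₄ :* v)) :* (w :* v) :+
           (d :* v :+ e :* v) :* (w :* v :* (w :* v) :* (w :* v) :* (w :* v)))
           refl d e r₁ r₂ r₃ r₄ w v 2ℚ ⟩
    2r * (w * v) + d+e * (w * v * (w * v) * (w * v) * (w * v))
      ≡⟨ cong₂ _+_ (sym (insert 2r)) (sym (insert⁴ d+e)) ⟩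
    2r + d+e
      ∎
    where
    abcde = a * v * (b * v) * (c * v) * (d * v) * (e * v)
    2abc  = 2ℚ * (a * v) * (b * v) * (c * v)
    a+b+c = a * v + b * v + c * v
    d+e   = d * v + e * v
    2r    = 2ℚ * (r₁ * v * (r₂ * v) * (r₃ * v) * (r₄ * v))
    insert : ∀ x → x ≡ x * (w * v)
    insert x = trans (sym (*-identityʳ x)) (cong (x *_) (sym wv≡1))
    insert² : ∀ x → x ≡ x * (w * v * (w * v))
    insert² x = trans (insert x) (cong (x *_) (insert (w * v)))
    insert⁴ : ∀ x → x ≡ x * (w * v * (w * v) * (w * v) * (w * v))
    insert⁴ x = trans (insert² x)
      (cong (x *_) (trans (insert (w * v * (w * v))) (insert (w * v * (w * v) * (w * v)))))

-- Regularity expressed through square roots.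

-- The right side of the regularity equation is the square of 2rs, so it is enough that a + b - c -
-- d is one of its two roots. The root -2rs is chosen, which can be stated without subtraction.
quad-regular : ∀ a b c d r s → a * b + 1ℚ ≡ r * r → c * d + 1ℚ ≡ s * s →
               a + b + 2ℚ * (r * s) ≡ c + d → RegularQuadEq a b c d
quad-regular a b c d r s ab cd sum = begin
  (a + b - c - d) * (a + b - c - d)
    ≡⟨ solve 4 (λ a b c d → (a :+ b :- c :- d) :* (a :+ b :- c :- d) :=
         (a :+ b :- (c :+ d)) :* (a :+ b :- (c :+ d))) refl a b c d ⟩
  (a + b - (c + d)) * (a + b - (c + d))
    ≡⟨ cong (λ x → (a + b - x) * (a + b - x)) sum ⟨
  (a + b - (a + b + 2ℚ * (r * s))) * (a + b - (a + b + 2ℚ * (r * s)))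
    ≡⟨ solve 5 (λ a b r s two →
         (a :+ b :- (a :+ b :+ two :* (r :* s))) :* (a :+ b :- (a :+ b :+ two :* (r :* s))) :=
         two :* two :* (r :* r) :* (s :* s)) refl a b r s 2ℚ ⟩
  4ℚ * (r * r) * (s * s)
    ≡⟨ cong₂ (λ x y → 4ℚ * x * y) ab cd ⟨
  4ℚ * (a * b + 1ℚ) * (c * d + 1ℚ)
    ∎
  where open ≡-Reasoning

-- Again a root of the regularity equation, this time the one with sign plus; `d + e` is moved
-- across to avoid subtraction.
quint-regular : ∀ a b c d e r₁ r₂ r₃ r₄ →
  a * b + 1ℚ ≡ r₁ * r₁ → a * c + 1ℚ ≡ r₂ * r₂ → b * c + 1ℚ ≡ r₃ * r₃ → d * e + 1ℚ ≡ r₄ * r₄ →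
  a * b * c * d * e + 2ℚ * a * b * c + (a + b + c) ≡ 2ℚ * (r₁ * r₂ * r₃ * r₄) + (d + e) →
  RegularQuintEq a b c d e
quint-regular a b c d e r₁ r₂ r₃ r₄ ab ac bc de sum = begin
  z * z
    ≡⟨ cong (λ x → x * x) z≡2r ⟩
  2ℚ * r * (2ℚ * r)
    ≡⟨ solve 5 (λ r₁ r₂ r₃ r₄ two →
         two :* (r₁ :* r₂ :* r₃ :* r₄) :* (two :* (r₁ :* r₂ :* r₃ :* r₄)) :=
         two :* two :* (r₁ :* r₁) :* (r₂ :* r₂) :* (r₃ :* r₃) :* (r₄ :* r₄))
         refl r₁ r₂ r₃ r₄ 2ℚ ⟩
  4ℚ * (r₁ * r₁) * (r₂ * r₂) * (r₃ * r₃) * (r₄ * r₄)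
    ≡⟨ cong₂ (λ x y → 4ℚ * x * y * (r₃ * r₃) * (r₄ * r₄)) ab ac ⟨
  4ℚ * (a * b + 1ℚ) * (a * c + 1ℚ) * (r₃ * r₃) * (r₄ * r₄)
    ≡⟨ cong₂ (λ x y → 4ℚ * (a * b + 1ℚ) * (a * c + 1ℚ) * x * y) bc de ⟨
  4ℚ * (a * b + 1ℚ) * (a * c + 1ℚ) * (b * c + 1ℚ) * (d * e + 1ℚ)
    ∎
  where
  open ≡-Reasoning
  r = r₁ * r₂ * r₃ * r₄
  abcde = a * b * c * d * e
  2abc  = 2ℚ * a * b * c
  z = abcde + 2abc + a + b + c - d - e
  z≡2r : z ≡ 2ℚ * r
  z≡2r = begin
    z
      ≡⟨ solve 7 (λ p q a b c d e → p :+ q :+ a :+ b :+ c :- d :- e :=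
           p :+ q :+ (a :+ b :+ c) :- (d :+ e)) refl abcde 2abc a b c d e ⟩
    abcde + 2abc + (a + b + c) - (d + e)
      ≡⟨ cong (_- (d + e)) sum ⟩
    2ℚ * r + (d + e) - (d + e)
      ≡⟨ solve 2 (λ p q → p :+ q :- q := p) refl (2ℚ * r) (d + e) ⟩
    2ℚ * r
      ∎

-- Ordered families and their smallest members.

lookup-AllPairs : ∀ {A : Set} {R : A → A → Set} {n} {xs : Vec A n} → AllPairs R xs →
                  ∀ i j → i Fin.< j → R (lookup xs i) (lookup xs j)
lookup-AllPairs (px ∷ _)  zero    (suc j) _         = lookup⁺ px j
lookup-AllPairs (_ ∷ pxs) (suc i) (suc j) (s≤s i<j) = lookup-AllPairs pxs i j i<j

Decreasing : ∀ {n} → (Fin n → ℚ) → Set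
Decreasing x = ∀ i j → i Fin.< j → x j < x i

Decreasing⇒Injective : ∀ {n} {x : Fin n → ℚ} → Decreasing x → Injective _≡_ _≡_ x
Decreasing⇒Injective dec {i} {j} xi≡xj with Fin.<-cmp i j
... | tri< i<j _ _ = contradiction (sym xi≡xj) (<⇒≢ (dec i j i<j))
... | tri≈ _ i≡j _ = i≡j
... | tri> _ _ j<i = contradiction xi≡xj (<⇒≢ (dec j i j<i))

last-≤ : ∀ {n} {x : Fin (suc n) → ℚ} → Decreasing x → ∀ i → x (fromℕ n) ≤ x i
last-≤ {n} {x} dec i with ℕ.m≤n⇒m<n∨m≡n (Fin.≤fromℕ i)
... | inj₁ i<l = <⇒≤ (dec i (fromℕ n) i<l)
... | inj₂ i≡l = ≤-reflexive (cong x (sym (Fin.toℕ-injective i≡l)))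

-- The last entry of a decreasing family is the minimum of its values, and a minimum depends only on
-- the set.
SameSet⇒last≡ : ∀ {n} {x y : Fin (suc n) → ℚ} → Decreasing x → Decreasing y →
                SameSet x y → x (fromℕ n) ≡ y (fromℕ n)
SameSet⇒last≡ {n} dx dy (x⊆y , y⊆x) = ≤-antisym (bound dx y⊆x) (bound dy x⊆y)
  where
  bound : ∀ {x y : Fin (suc n) → ℚ} → Decreasing x → ImageSub y x → x (fromℕ n) ≤ y (fromℕ n)
  bound dx y⊆x with y⊆x (fromℕ n)
  ... | i , y≡x = ≤-trans (last-≤ dx i) (≤-reflexive (sym y≡x))

module _ {x : ℕ → ℚ} (step : ∀ n → x (suc n) < x n) where

  step⇒antitone : ∀ {m n} → suc m ℕ.≤′ n → x n < x m
  step⇒antitone ℕ.≤′-refl       = step _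
  step⇒antitone (ℕ.≤′-step m<n) = <-trans (step _) (step⇒antitone m<n)

  step⇒injective : ∀ {m n} → x m ≡ x n → m ≡ n
  step⇒injective {m} {n} xm≡xn with ℕ.<-cmp m n
  ... | tri< m<n _ _ = contradiction (sym xm≡xn) (<⇒≢ (step⇒antitone (ℕ.≤⇒≤′ m<n)))
  ... | tri≈ _ m≡n _ = m≡n
  ... | tri> _ _ n<m = contradiction xm≡xn (<⇒≢ (step⇒antitone (ℕ.≤⇒≤′ n<m)))

-- Fractions of polynomials over one positive denominator.

module Fraction (W : Poly) (0≪W : con 0 ≪ W) where

  private
    W-positive : ∀ n → Positive (⟦ W ⟧ (ι n))
    W-positive n = positive (subst (_< ⟦ W ⟧ (ι n)) ι-0 (⟦⟧-≪ 0≪W (0≤ι n)))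

    W-nonZero : ∀ n → NonZero (⟦ W ⟧ (ι n))
    W-nonZero n = pos⇒nonZero (⟦ W ⟧ (ι n)) {{W-positive n}}

    W⁻¹ : ℕ → ℚ
    W⁻¹ n = (1/ ⟦ W ⟧ (ι n)) {{W-nonZero n}}

    W*W⁻¹ : ∀ n → ⟦ W ⟧ (ι n) * W⁻¹ n ≡ 1ℚ
    W*W⁻¹ n = *-inverseʳ (⟦ W ⟧ (ι n)) {{W-nonZero n}}

    instance
      W⁻¹-positive : ∀ {n} → Positive (W⁻¹ n)
      W⁻¹-positive {n} = 1/pos⇒pos (⟦ W ⟧ (ι n)) {{W-positive n}}

  value : Poly → ℕ → ℚ
  value p n = ⟦ p ⟧ (ι n) * W⁻¹ n

  module _ (n : ℕ) where

    private
      x = ι n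
      w = ⟦ W ⟧ x

    value-< : ∀ p q → p ≪ q → value p n < value q n
    value-< p q p≪q = *-monoˡ-<-pos (W⁻¹ n) {{W⁻¹-positive {n}}} (⟦⟧-≪ p≪q (0≤ι n))

    0<value : ∀ p → con 0 ≪ p → 0ℚ < value p n
    0<value p 0≪p = subst (_< value p n) (trans (cong (_* W⁻¹ n) ι-0) (*-zeroˡ (W⁻¹ n)))
      (value-< (con 0) p 0≪p)

    value-square : ∀ p q r → p ⊗ q ⊕ W ⊗ W ≈ r ⊗ r →
                   value p n * value q n + 1ℚ ≡ value r n * value r n
    value-square p q r eq =
      scaled-square {w} (W*W⁻¹ n) (⟦ p ⟧ x) (⟦ q ⟧ x) (⟦ r ⟧ x) (⟦⟧-≈ eq x)

    value-quad : ∀ p q p′ q′ r s →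
      p ⊗ q ⊕ W ⊗ W ≈ r ⊗ r → p′ ⊗ q′ ⊕ W ⊗ W ≈ s ⊗ s →
      (p ⊕ q) ⊗ W ⊕ con 2 ⊗ (r ⊗ s) ≈ (p′ ⊕ q′) ⊗ W →
      RegularQuadEq (value p n) (value q n) (value p′ n) (value q′ n)
    value-quad p q p′ q′ r s pq p′q′ sum =
      quad-regular (value p n) (value q n) (value p′ n) (value q′ n) (value r n) (value s n)
        (value-square p q r pq) (value-square p′ q′ s p′q′)
        (scaled-sum {w} (W*W⁻¹ n) (⟦ p ⟧ x) (⟦ q ⟧ x) (⟦ p′ ⟧ x) (⟦ q′ ⟧ x) (⟦ r ⟧ x) (⟦ s ⟧ x)
          -- `con 2` evaluates to the opaque `ι 2`, which only `ι-2` identifies with `2ℚ`.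
          (subst (λ two → (⟦ p ⟧ x + ⟦ q ⟧ x) * w + two * (⟦ r ⟧ x * ⟦ s ⟧ x) ≡
                          (⟦ p′ ⟧ x + ⟦ q′ ⟧ x) * w) ι-2
            (⟦⟧-≈ sum x)))

    value-quint : ∀ a b c d e r₁ r₂ r₃ r₄ →
      a ⊗ b ⊕ W ⊗ W ≈ r₁ ⊗ r₁ → a ⊗ c ⊕ W ⊗ W ≈ r₂ ⊗ r₂ →
      b ⊗ c ⊕ W ⊗ W ≈ r₃ ⊗ r₃ → d ⊗ e ⊕ W ⊗ W ≈ r₄ ⊗ r₄ →
      a ⊗ b ⊗ c ⊗ d ⊗ e ⊕ con 2 ⊗ a ⊗ b ⊗ c ⊗ (W ⊗ W) ⊕ (a ⊕ b ⊕ c) ⊗ (W ⊗ W ⊗ W ⊗ W) ≈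
        con 2 ⊗ (r₁ ⊗ r₂ ⊗ r₃ ⊗ r₄) ⊗ W ⊕ (d ⊕ e) ⊗ (W ⊗ W ⊗ W ⊗ W) →
      RegularQuintEq (value a n) (value b n) (value c n) (value d n) (value e n)
    value-quint a b c d e r₁ r₂ r₃ r₄ ab ac bc de sum =
      quint-regular (value a n) (value b n) (value c n) (value d n) (value e n)
        (value r₁ n) (value r₂ n) (value r₃ n) (value r₄ n)
        (value-square a b r₁ ab) (value-square a c r₂ ac)
        (value-square b c r₃ bc) (value-square d e r₄ de)
        (scaled-quint {w} (W*W⁻¹ n) A B C D E R₁ R₂ R₃ R₄
          (subst (λ two →
              A * B * C * D * E + two * A * B * C * (w * w) + (A + B + C) * (w * w * w * w) ≡
              two * (R₁ * R₂ * R₃ * R₄) * w + (D + E) * (w * w * w * w)) ι-2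
            (⟦⟧-≈ sum x)))
      where
      A = ⟦ a ⟧ x
      B = ⟦ b ⟧ x
      C = ⟦ c ⟧ x
      D = ⟦ d ⟧ x
      E = ⟦ e ⟧ x
      R₁ = ⟦ r₁ ⟧ x
      R₂ = ⟦ r₂ ⟧ x
      R₃ = ⟦ r₃ ⟧ x
      R₄ = ⟦ r₄ ⟧ x

  -- Both denominators are positive, so the fractions may be cross-multiplied. Substituting 1 + X
  -- turns values at n + 1 into values at n, and the claim for all n becomes one comparison of
  -- coefficients.
  value-step : ∀ p → p [ con 1 ⊕ X ] ⊗ W ≪ p ⊗ W [ con 1 ⊕ X ] →
               ∀ n → value p (suc n) < value p n
  value-step p p≪ n = begin-strict
    p₁ * v₁              ≡⟨ cancel p₁ w v v₁ (W*W⁻¹ n) ⟨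
    p₁ * w * (v * v₁)    <⟨ *-monoˡ-<-pos (v * v₁) {{pos*pos⇒pos v v₁}} cross ⟩
    p₀ * w₁ * (v * v₁)   ≡⟨ cong (p₀ * w₁ *_) (*-comm v v₁) ⟩
    p₀ * w₁ * (v₁ * v)   ≡⟨ cancel p₀ w₁ v₁ v (W*W⁻¹ (suc n)) ⟩
    p₀ * v               ∎
    where
    open ≤-Reasoning
    p₀ = ⟦ p ⟧ (ι n)
    p₁ = ⟦ p ⟧ (ι (suc n))
    w  = ⟦ W ⟧ (ι n)
    w₁ = ⟦ W ⟧ (ι (suc n))
    v  = W⁻¹ n
    v₁ = W⁻¹ (suc n)
    instance
      _ = W⁻¹-positive {n}
      _ = W⁻¹-positive {suc n}
    shift : ∀ q → ⟦ q [ con 1 ⊕ X ] ⟧ (ι n) ≡ ⟦ q ⟧ (ι (suc n))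
    shift q = trans (⟦⟧-[] q (con 1 ⊕ X) (ι n)) (cong ⟦ q ⟧ (sym (ι-+ 1 n)))
    cross : p₁ * w < p₀ * w₁
    cross = subst₂ (λ y z → y * w < p₀ * z) (shift p) (shift W)
      (⟦⟧-≪ p≪ (0≤ι n))
    cancel : ∀ y w v z → w * v ≡ 1ℚ → y * w * (v * z) ≡ y * z
    cancel y w v z wv≡1 =
      trans (solve 4 (λ y w v z → y :* w :* (v :* z) := y :* z :* (w :* v)) refl y w v z)
        (trans (cong (y * z *_) wv≡1) (*-identityʳ (y * z)))

-- The parametric family.

-- The singleton clause avoids a product with the zero polynomial, which would leave trailing zeros
-- in the coefficient list; `_≡ᶜ_` distinguishes lists that differ in these.
horner : List ℕ → Poly → Poly
horner []              r = con 0
horner (c ∷ [])        r = con c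
horner (c ∷ p@(_ ∷ _)) r = con c ⊕ r ⊗ horner p r

-- The numbers of the sextuple are the polynomials a, …, d′ below divided by the common denominator W.
h k K G₁ G₂ G L s t u W : Poly
k  = X ⊕ con 30
h  = X ⊕ con 31
s  = h ⊕ con 2
t  = con 2 ⊗ h ⊕ con 1
u  = h ⊗ h ⊕ con 1
K  = horner (1 ∷ 10 ∷ 14 ∷ 10 ∷ 1 ∷ []) h
G₁ = horner (3 ∷ 2 ∷ 1 ∷ []) h
G₂ = horner (1 ∷ 2 ∷ 3 ∷ []) h
G  = G₁ ⊗ G₂
L  = k ⊗ k ⊗ k ⊗ (h ⊕ con 1) ⊗ K
W  = con 2 ⊗ h ⊗ h ⊗ s ⊗ s ⊗ t ⊗ t ⊗ u ⊗ u ⊗ G ⊗ L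

-- From m + n = 2/a and mn = -f/a come `a`/`W` = 2/(m+n) and `f`/`W` = -2mn/(m+n). The substitution
-- of 1/h for h changes only the sign of these two, hence their palindromic coefficient lists.
a f b b′ d d′ : Poly
a  = con 4 ⊗ h ⊗ h ⊗ (h ⊗ h ⊕ h ⊕ con 1) ⊗ horner
       (25 ∷ 345 ∷ 2643 ∷ 13208 ∷ 47782 ∷ 129896 ∷ 273634 ∷ 458136 ∷ 620748 ∷ 686302 ∷
        620748 ∷ 458136 ∷ 273634 ∷ 129896 ∷ 47782 ∷ 13208 ∷ 2643 ∷ 345 ∷ 25 ∷ []) h
f  = h ⊗ h ⊗ k ⊗ k ⊗ (h ⊕ con 1) ⊗ (h ⊕ con 1) ⊗ horner
       (49 ∷ 672 ∷ 3952 ∷ 14536 ∷ 40328 ∷ 87848 ∷ 152448 ∷ 211952 ∷ 236142 ∷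
        211952 ∷ 152448 ∷ 87848 ∷ 40328 ∷ 14536 ∷ 3952 ∷ 672 ∷ 49 ∷ []) h
b  = h ⊗ h ⊗ t ⊗ t ⊗ u ⊗ u ⊗ L ⊗ L
b′ = con 4 ⊗ h ⊗ h ⊗ h ⊗ h ⊗ s ⊗ s ⊗ s ⊗ s ⊗ t ⊗ t ⊗ u ⊗ u ⊗ (u ⊕ con 1) ⊗ G ⊗ G
d  = s ⊗ s ⊗ u ⊗ u ⊗ L ⊗ L
d′ = con 4 ⊗ s ⊗ s ⊗ t ⊗ t ⊗ t ⊗ t ⊗ u ⊗ u ⊗ (con 2 ⊗ h ⊗ h ⊕ con 1) ⊗ G ⊗ G

-- √xy is W times a square root of (x/W)(y/W) + 1.  The substitution h ↦ 1/h exchanges b/W with d/W and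
-- b′/W with d′/W up to sign, whence the reversed coefficient lists.
ab-coeffs ab′-coeffs bf-coeffs b′f-coeffs : List ℕ
ab-coeffs  = 13 ∷ 77 ∷ 242 ∷ 508 ∷ 795 ∷ 886 ∷ 729 ∷ 428 ∷ 168 ∷ 37 ∷ 5 ∷ []
ab′-coeffs = 1 ∷ 10 ∷ 111 ∷ 462 ∷ 1180 ∷ 2012 ∷ 2542 ∷ 2368 ∷ 1673 ∷ 882 ∷ 339 ∷ 74 ∷ 10 ∷ []
bf-coeffs  = 25 ∷ 144 ∷ 399 ∷ 708 ∷ 894 ∷ 776 ∷ 506 ∷ 260 ∷ 121 ∷ 48 ∷ 7 ∷ []
b′f-coeffs = 1 ∷ 10 ∷ 61 ∷ 174 ∷ 358 ∷ 462 ∷ 416 ∷ 282 ∷ 125 ∷ 48 ∷ 7 ∷ []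

√ab √ab′ √ad √ad′ √af √bb′ √bd √bd′ √b′d √b′d′ √bf √b′f √dd′ √df √d′f : Poly
√ab   = con 2 ⊗ h ⊗ h ⊗ t ⊗ u ⊗ L ⊗ horner ab-coeffs h
√ad   = con 2 ⊗ h ⊗ s ⊗ u ⊗ L ⊗ horner (reverse ab-coeffs) h
√ab′  = con 2 ⊗ h ⊗ h ⊗ s ⊗ s ⊗ t ⊗ u ⊗ G ⊗ horner ab′-coeffs h
√ad′  = con 2 ⊗ h ⊗ s ⊗ t ⊗ t ⊗ u ⊗ G ⊗ horner (reverse ab′-coeffs) h
√bf   = h ⊗ h ⊗ t ⊗ u ⊗ L ⊗ horner bf-coeffs h
√df   = h ⊗ s ⊗ u ⊗ L ⊗ horner (reverse bf-coeffs) h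
√b′f  = con 2 ⊗ h ⊗ h ⊗ s ⊗ s ⊗ t ⊗ u ⊗ G ⊗ k ⊗ (h ⊕ con 1) ⊗ horner b′f-coeffs h
√d′f  = con 2 ⊗ h ⊗ s ⊗ t ⊗ t ⊗ u ⊗ G ⊗ k ⊗ (h ⊕ con 1) ⊗ horner (reverse b′f-coeffs) h
√af   = con 2 ⊗ h ⊗ h ⊗ k ⊗ (h ⊕ con 1) ⊗ horner
          (37 ∷ 533 ∷ 3658 ∷ 16184 ∷ 53299 ∷ 136304 ∷ 277129 ∷ 455192 ∷ 610645 ∷ 673174 ∷
           610645 ∷ 455192 ∷ 277129 ∷ 136304 ∷ 53299 ∷ 16184 ∷ 3658 ∷ 533 ∷ 37 ∷ []) h
√bd   = h ⊗ s ⊗ t ⊗ u ⊗ u ⊗ L ⊗ horner (1 ∷ 8 ∷ 66 ∷ 152 ∷ 194 ∷ 152 ∷ 66 ∷ 8 ∷ 1 ∷ []) h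
√b′d′ = con 2 ⊗ h ⊗ h ⊗ s ⊗ s ⊗ t ⊗ t ⊗ u ⊗ u ⊗ G ⊗
        horner (17 ∷ 88 ∷ 230 ∷ 392 ∷ 490 ∷ 392 ∷ 230 ∷ 88 ∷ 17 ∷ []) h
√b′d  = con 2 ⊗ h ⊗ h ⊗ s ⊗ s ⊗ t ⊗ u ⊗ u ⊗ G ⊗ L ⊗ G₁
√bd′  = con 2 ⊗ h ⊗ s ⊗ t ⊗ t ⊗ u ⊗ u ⊗ G ⊗ L ⊗ G₂
√bb′  = u ⊗ W
√dd′  = con 2 ⊗ s ⊗ s ⊗ t ⊗ t ⊗ u ⊗ u ⊗ u ⊗ G ⊗ L

numerators : Vec Poly 6
numerators = b′ ∷ b ∷ a ∷ f ∷ d ∷ d′ ∷ []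

Linked : Poly → Poly → Set
Linked p q = q ≪ p × ∃ λ r → p ⊗ q ⊕ W ⊗ W ≈ r ⊗ r

pattern link r = by-coeffs tt , r , by-coeffs tt

-- The fifteen pairs as an upper triangle; each entry supplies a root, and the order and the square
-- identity are computed. The order explains the offset 31 in `h`: at h = 30 the member from `d` is
-- still below the one from `d′`.
linked : AllPairs Linked numerators
linked =
  (link √bb′ ∷ link √ab′ ∷ link √b′f ∷ link √b′d ∷ link √b′d′ ∷ []) ∷
  (link √ab ∷ link √bf ∷ link √bd ∷ link √bd′ ∷ []) ∷
  (link √af ∷ link √ad ∷ link √ad′ ∷ []) ∷
  (link √df ∷ link √d′f ∷ []) ∷
  (link √dd′ ∷ []) ∷
  [] ∷ []

-- The sextuples and their regular subsets.

open Fraction W (by-coeffs tt)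

sextuple : ℕ → Fin 6 → ℚ
sextuple n i = value (lookup numerators i) n

linked⇒> : ∀ n {p q} → Linked p q → value q n < value p n
linked⇒> n {p} {q} (q≪p , _) = value-< n q p q≪p

linked⇒square : ∀ n {p q} → Linked p q → IsRatSquare (value p n * value q n + 1ℚ)
linked⇒square n {p} {q} (_ , r , eq) = value r n , value-square n p q r eq

sextuple-decreasing : ∀ n → Decreasing (sextuple n)
sextuple-decreasing n i j i<j = linked⇒> n (lookup-AllPairs linked i j i<j)

sextuple-positive : ∀ n i → 0ℚ < sextuple n i
sextuple-positive n i = <-≤-trans (0<value n d′ (by-coeffs tt)) (last-≤ (sextuple-decreasing n) i)

sextuple-square : ∀ n i j → i ≢ j → IsRatSquare (sextuple n i * sextuple n j + 1ℚ)
sextuple-square n i j i≢j = by-order (Fin.<-cmp i j)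
  where
  by-order : Tri (i Fin.< j) (i ≡ j) (j Fin.< i) → IsRatSquare (sextuple n i * sextuple n j + 1ℚ)
  by-order (tri< i<j _ _) = linked⇒square n (lookup-AllPairs linked i j i<j)
  by-order (tri≈ _ i≡j _) = contradiction i≡j i≢j
  by-order (tri> _ _ j<i) = subst (λ y → IsRatSquare (y + 1ℚ)) (*-comm (sextuple n j) (sextuple n i))
    (linked⇒square n (lookup-AllPairs linked j i j<i))

decide-injective : ∀ {m n} (g : Fin m → Fin n) →
  {True (Fin.all? λ i → Fin.all? λ j → (g i Fin.≟ g j) →-dec (i Fin.≟ j))} →
  Injective _≡_ _≡_ g
decide-injective g {t} {i} {j} = toWitness t i j

quint : Fin 5 → Fin 6
quint = lookup (2F ∷ 0F ∷ 1F ∷ 4F ∷ 5F ∷ [])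

quad₁ quad₂ : Fin 4 → Fin 6
quad₁ = lookup (2F ∷ 3F ∷ 0F ∷ 1F ∷ [])
quad₂ = lookup (4F ∷ 5F ∷ 2F ∷ 3F ∷ [])

quad₁≢quad₂ : ¬ SameSet quad₁ quad₂
-- Position 2 of `quad₁` is the index of `b′`, which `quad₂` omits.
quad₁≢quad₂ (quad₁⊆quad₂ , _) with quad₁⊆quad₂ 2F
... | 0F , ()
... | 1F , ()
... | 2F , ()
... | 3F , ()

good : ∀ n → GoodSextuple (sextuple n)
good n =
  ( Decreasing⇒Injective (sextuple-decreasing n)
  , (λ i x≡0 → <⇒≢ (sextuple-positive n i) (sym x≡0))
  , sextuple-square n ) ,
  ( quint , decide-injective quint
  -- With `a`, `b′`, `b` as the triple and `d`, `d′` as the pair, the root equation holds for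
  -- positive roots.
  , value-quint n a b′ b d d′ √ab′ √ab √bb′ √dd′
      (by-coeffs tt) (by-coeffs tt) (by-coeffs tt) (by-coeffs tt) (by-coeffs tt) ) ,
  ( quad₁ , quad₂
  -- Here S = -`u` and T = `u`/h², so that ST = S - T, while `√af`/`W` is -r. The regularity
  -- relations are a + f + 2rS = b + b′ and a + f + 2rT = d + d′. As rS > 0 > rT, positive roots
  -- require `a`, `f` to come first here and last in `quad₂`.
  , (decide-injective quad₁ , value-quad n a f b′ b √af √bb′ (by-coeffs tt) (by-coeffs tt) (by-coeffs tt))
  , (decide-injective quad₂ , value-quad n d d′ a f √dd′ √af (by-coeffs tt) (by-coeffs tt) (by-coeffs tt))
  , quad₁≢quad₂ )

theorem1 : ∃ λ (S : ℕ → Fin 6 → ℚ) →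
    (∀ n → GoodSextuple (S n)) ×
    (∀ n m → n ≢ m → ¬ SameSet (S n) (S m))
theorem1 = sextuple , good , λ n m n≢m same →
  -- Equal sets have equal minima, and the minimum, `d′` over `W`, strictly decreases with the
  -- index.
  n≢m (step⇒injective (value-step d′ (by-coeffs tt))
    (SameSet⇒last≡ (sextuple-decreasing n) (sextuple-decreasing m) same))
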